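{- Let $\mathcal{G}$ be a connected graph and let $\mathcal{T}$ be a spanning tree of $\mathcal{G}$. Consider $\mathcal{T}$ as a bipartite graph, and let $a$ and $b$ be the numbers of vertices in its two color classes. Then $$M(\mathcal{G})\ge a+b+\binom{a}{2}+\binom{b}{2}.$$
   Context: Graphs are finite, simple and undirected. For a graph $\mathcal{G}$ with $n$ vertices and adjacency matrix $A$, viewed over $\mathbb{F}_2$, let $C(\mathcal{G})\subseteq\mathbb{F}_2^{2n}$ be the binary linear code generated by the rows of $[I_n|A]$, where $I_n$ is the $n\times n$ identity matrix. The support of a vector is the set of positions of its nonzero entries. A nonzero codeword $c$ of a binary linear code $C$ is minimal if there is no nonzero codeword $c'\in C$ with $\operatorname{supp}(c')\subsetneq\operatorname{supp}(c)$. $M(\mathcal{G})$ denotes the number of minimal codewords of $C(\mathcal{G})$; it does not depend on the labeling of the vertices. -}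

module Defs where

open import Data.Bool using (Bool; true; false; _∧_; _xor_)
import Data.Bool.Properties as Bool
open import Data.Fin using (Fin; zero; suc; inject₁; fromℕ)
import Data.Fin.Properties as Fin
open import Data.Fin.Subset using (Subset; _⊂_)
open import Data.Fin.Subset.Properties using (anySubset?; _⊂?_)
open import Data.List as List using (List; length; filter)
open import Data.Nat using (ℕ; zero; suc; _+_)
open import Data.Product using (∃; ∃-syntax; _×_)
open import Data.Vec using (Vec; []; _∷_; map; zipWith; replicate; tabulate; _++_)
open import Data.Vec.Properties using (≡-dec)
open import Function.Definitions using (Injective)
open import Level using (0ℓ)
open import Relation.Binary.Construct.Closure.ReflexiveTransitive using (Star)
open import Relation.Binary.PropositionalEquality using (_≡_; _≢_)
open import Relation.Nullary using (¬_; Dec; does; ¬?; _×-dec_)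
open import Relation.Unary using (Pred; Decidable; _∈_)

-- 𝔽₂ has 0 = false, 1 = true, addition _xor_ and multiplication _∧_.
𝔽₂ : Set
𝔽₂ = Bool

Word : ℕ → Set
Word m = Vec 𝔽₂ m

Matrix : ℕ → ℕ → Set
Matrix k m = Vec (Word m) k

infixl 6 _⊕_
infixr 7 _·_

𝟎 : ∀ {m} → Word m
𝟎 = replicate _ false

_⊕_ : ∀ {m} → Word m → Word m → Word m
_⊕_ = zipWith _xor_

_·_ : ∀ {m} → 𝔽₂ → Word m → Word m
a · v = map (a ∧_) v

combination : ∀ {k m} → Word k → Matrix k m → Word m
combination []       []       = 𝟎
combination (a ∷ as) (r ∷ rs) = a · r ⊕ combination as rs

rowSpan : ∀ {k m} → Matrix k m → Pred (Word m) 0ℓ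
rowSpan R c = ∃[ x ] combination x R ≡ c

-- Subset m is Vec Bool m, with true marking the members, so over 𝔽₂ a word is
-- already the characteristic vector of its set of nonzero positions.
supp : ∀ {m} → Word m → Subset m
supp c = c

IsMinimal : ∀ {m} → Pred (Word m) 0ℓ → Pred (Word m) 0ℓ
IsMinimal C c =
  c ∈ C × c ≢ 𝟎 × ¬ (∃[ c′ ] (c′ ∈ C × c′ ≢ 𝟎 × supp c′ ⊂ supp c))

_≟ʷ_ : ∀ {m} (c d : Word m) → Dec (c ≡ d)
_≟ʷ_ = ≡-dec Bool._≟_

-- anySubset? searches all of Vec Bool k, i.e. all of 𝔽₂ᵏ.
rowSpan? : ∀ {k m} (R : Matrix k m) → Decidable (rowSpan R)
rowSpan? R c = anySubset? (λ x → combination x R ≟ʷ c)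

isMinimal? : ∀ {m} {C : Pred (Word m) 0ℓ} → Decidable C → Decidable (IsMinimal C)
isMinimal? C? c =
  C? c ×-dec ¬? (c ≟ʷ 𝟎) ×-dec
  ¬? (anySubset? (λ c′ → C? c′ ×-dec ¬? (c′ ≟ʷ 𝟎) ×-dec (supp c′ ⊂? supp c)))

-- Every word of length m occurs exactly once.
allWords : ∀ m → List (Word m)
allWords zero    = List.[ [] ]
allWords (suc m) =
  List.map (false ∷_) (allWords m) List.++ List.map (true ∷_) (allWords m)

record Graph (n : ℕ) : Set where
  field
    adj        : Fin n → Fin n → Bool
    adj-sym    : ∀ u v → adj u v ≡ adj v u
    adj-irrefl : ∀ v → adj v v ≡ false

  Adj : Fin n → Fin n → Set
  Adj u v = adj u v ≡ true

open Graph public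

identityMatrix : ∀ n → Matrix n n
identityMatrix n = tabulate (λ i → tabulate (λ j → does (i Fin.≟ j)))

adjacencyMatrix : ∀ {n} → Graph n → Matrix n n
adjacencyMatrix G = tabulate (λ i → tabulate (λ j → adj G i j))

-- The block matrix [ Iₙ | A ].
generatorMatrix : ∀ {n} → Graph n → Matrix n (n + n)
generatorMatrix {n} G = zipWith _++_ (identityMatrix n) (adjacencyMatrix G)

code : ∀ {n} → Graph n → Pred (Word (n + n)) 0ℓ
code G = rowSpan (generatorMatrix G)

M : ∀ {n} → Graph n → ℕ
M {n} G = length (filter (isMinimal? (rowSpan? (generatorMatrix G))) (allWords (n + n)))

-- Star (Adj G) u v is the type of walks from u to v.  The graph without
-- vertices counts as connected.
Connected : ∀ {n} → Graph n → Set
Connected G = ∀ u v → Star (Adj G) u v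

-- A cycle is v₀, …, v₍ₖ₊₂₎: at least three distinct vertices, consecutive ones
-- adjacent, and the last adjacent to the first.
record Cycle {n} (G : Graph n) : Set where
  field
    k         : ℕ
    vertex    : Fin (3 + k) → Fin n
    injective : Injective _≡_ _≡_ vertex
    step      : ∀ (i : Fin (2 + k)) → Adj G (vertex (inject₁ i)) (vertex (suc i))
    close     : Adj G (vertex (fromℕ (2 + k))) (vertex zero)

IsTree : ∀ {n} → Graph n → Set
IsTree G = Connected G × ¬ Cycle G

-- Both graphs have vertex set Fin n, so a subgraph here is always spanning.
_IsSpanningTreeOf_ : ∀ {n} → Graph n → Graph n → Set
T IsSpanningTreeOf G = IsTree T × (∀ u v → Adj T u v → Adj G u v)

IsTwoColouring : ∀ {n} → Graph n → (Fin n → Bool) → Set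
IsTwoColouring G κ = ∀ u v → Adj G u v → κ u ≢ κ v

colourClass : ∀ {n} → (Fin n → Bool) → Bool → Subset n
colourClass κ x = tabulate (λ v → does (κ v Bool.≟ x))

{-# OPTIONS --safe #-}
module Submission where

-- The codeword of a vertex set S is (S , odd S), where odd S is the set of
-- vertices with an odd number of neighbours in S.  Call two vertices near when
-- they are equal or have a common neighbour in G.  The bound comes from an
-- injection of the unordered pairs {u , v}, with u = v allowed, of equally
-- coloured vertices into the minimal codewords; in a class of k vertices there
-- are k + k C 2 such pairs.
--
-- A walk in the spanning tree between equally coloured vertices u and v has even
-- length, so taking every second vertex of it gives a walk of near vertices.
-- Shortcuts make it an induced path of the nearness relation (join), and {u , v}
-- is sent to the codeword of the vertex set S of such a path.
--
-- This codeword is minimal (induced⇒minimal).  Consecutive vertices p and p′ of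
-- the path have a common neighbour q.  The neighbours of q are pairwise near,
-- and an induced path has no triangle, so p and p′ are the only neighbours of q
-- in S.  Hence q is not in odd S.  A codeword (S′ , odd S′) with support inside
-- that of (S , odd S) therefore has q outside odd S′, so S′ contains both or
-- none of p and p′.  Going along the path, S′ is empty or S.
--
-- The set S determines {u , v}: in an induced path the ends are exactly the
-- vertices near at most one other vertex of the path (ends-unique).

open import Defs
open import Algebra.Bundles using (CommutativeRing)
import Algebra.Properties.CommutativeMonoid.Sum as Sum
open import Data.Bool using (Bool; true; false; _∧_; _xor_)
import Data.Bool.Properties as Bool
open import Data.Empty using (⊥)
open import Data.Fin using (Fin; zero; suc; _↑ˡ_; _↑ʳ_; punchIn; punchOut)
import Data.Fin.Properties as Fin
open import Data.Fin.Subset using (∣_∣; _⊆_; _⊂_) renaming (_∈_ to _∈ˢ_)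
open import Data.List using (List; []; _∷_; [_]; _++_; map; length; filter; allFin)
import Data.List as List
import Data.List.Properties as List
open import Data.List.Membership.DecPropositional using () renaming (_∈?_ to member?)
open import Data.List.Membership.Propositional using (_∈_)
open import Data.List.Membership.Propositional.Properties
  using (∈-map⁺; ∈-++⁺ˡ; ∈-++⁺ʳ; ∈-filter⁺; ∈-lookup)
open import Data.List.Membership.Setoid.Properties using (index-injective)
open import Data.List.Relation.Unary.All as All using (All; []; _∷_)
import Data.List.Relation.Unary.All.Properties as All
open import Data.List.Relation.Unary.AllPairs as AllPairs using (AllPairs; []; _∷_)
import Data.List.Relation.Unary.AllPairs.Properties as AllPairs
open import Data.List.Relation.Unary.Any as Any using (Any; here; there)
open import Data.List.Relation.Unary.Unique.Propositional using (Unique)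
import Data.List.Relation.Unary.Unique.Propositional.Properties as Unique
open import Data.Nat using (ℕ; zero; suc; _+_; _≤_; _≥_)
open import Data.Nat.Combinatorics using (_C_; nC1≡n; nCk+nC[k+1]≡[n+1]C[k+1])
open import Data.Nat.Solver using (module +-*-Solver)
open import Data.Product using (∃; ∃-syntax; _×_; _,_; proj₁; proj₂)
open import Data.Sum using (_⊎_; inj₁; inj₂)
open import Data.Vec as Vec using (lookup; tabulate)
import Data.Vec.Properties as Vec
open import Function using (_∘_; id)
open import Relation.Binary.Construct.Closure.ReflexiveTransitive using (Star; ε; _◅_)
open import Relation.Binary.PropositionalEquality
  using (_≡_; _≢_; refl; sym; trans; cong; cong₂; subst; setoid; ≢-sym; module ≡-Reasoning)
open import Relation.Nullary using (¬_; Dec; yes; no; does; contradiction; _×-dec_; _⊎-dec_)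
open import Relation.Nullary.Decidable using (dec-true; dec-false)
import Relation.Unary as Unary

open Sum (CommutativeRing.+-commutativeMonoid Bool.xor-∧-commutativeRing)
  using (sum; sum-remove; sum-cong-≗; sum-replicate-zero)

-- Sums over 𝔽₂

does-true⁻ : ∀ {p} {P : Set p} (P? : Dec P) → does P? ≡ true → P
does-true⁻ (yes p) _ = p

xor-false⁻ : ∀ x y → x xor y ≡ false → x ≡ y
xor-false⁻ true  true  _ = refl
xor-false⁻ false false _ = refl

sum-single : ∀ {n} (t : Fin n → Bool) i → (∀ k → k ≢ i → t k ≡ false) → sum t ≡ t i
sum-single {suc n} t i off = begin
  sum t                                     ≡⟨ sum-remove {i = i} t ⟩
  t i xor sum (λ k → t (punchIn i k))       ≡⟨ cong (t i xor_) (sum-cong-≗ λ k → off _ (Fin.punchInᵢ≢i i k)) ⟩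
  t i xor sum {n} (λ _ → false)             ≡⟨ cong (t i xor_) (sum-replicate-zero n) ⟩
  t i xor false                             ≡⟨ Bool.xor-identityʳ (t i) ⟩
  t i                                       ∎
  where open ≡-Reasoning

sum-pair : ∀ {n} (t : Fin n → Bool) {i j} → i ≢ j →
           (∀ k → k ≢ i → k ≢ j → t k ≡ false) → sum t ≡ t i xor t j
sum-pair {suc n} t {i} {j} i≢j off = begin
  sum t                                     ≡⟨ sum-remove {i = i} t ⟩
  t i xor sum (λ k → t (punchIn i k))       ≡⟨ cong (t i xor_) (sum-single (t ∘ punchIn i) (punchOut i≢j) off′) ⟩
  t i xor t (punchIn i (punchOut i≢j))      ≡⟨ cong (λ k → t i xor t k) (Fin.punchIn-punchOut i≢j) ⟩
  t i xor t j                               ∎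
  where
  open ≡-Reasoning
  off′ : ∀ k → k ≢ punchOut i≢j → t (punchIn i k) ≡ false
  off′ k k≢ = off _ (Fin.punchInᵢ≢i i k) λ eq →
    k≢ (Fin.punchIn-injective i k _ (trans eq (sym (Fin.punchIn-punchOut i≢j))))

-- Codewords

lookup-combination : ∀ {k m} (x : Word k) (R : Matrix k m) j →
  lookup (combination x R) j ≡ sum (λ i → lookup x i ∧ lookup (lookup R i) j)
lookup-combination Vec.[]      Vec.[]      j = Vec.lookup-replicate j false
lookup-combination (a Vec.∷ x) (r Vec.∷ R) j =
  trans (Vec.lookup-zipWith _xor_ j (a · r) (combination x R))
        (cong₂ _xor_ (Vec.lookup-map j (a ∧_) r) (lookup-combination x R j))

-- The codeword with coefficient vector x.  By lookup-encodeˡ and lookup-encodeʳ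
-- its left half is x itself, and its right half counts, modulo 2, the neighbours
-- of each vertex in the set with characteristic vector x.
encode : ∀ {n} → Graph n → Word n → Word (n + n)
encode G x = combination x (generatorMatrix G)

module _ {n} (G : Graph n) where

  private
    I A : Matrix n n
    I = identityMatrix n
    A = adjacencyMatrix G

  lookup-generator : ∀ i → lookup (generatorMatrix G) i ≡ lookup I i Vec.++ lookup A i
  lookup-generator i = Vec.lookup-zipWith Vec._++_ i I A

  lookup-encodeˡ : ∀ x j → lookup (encode G x) (j ↑ˡ n) ≡ lookup x j
  lookup-encodeˡ x j = begin
    lookup (encode G x) (j ↑ˡ n)                       ≡⟨ lookup-combination x (generatorMatrix G) (j ↑ˡ n) ⟩
    sum (λ i → lookup x i ∧ lookup (lookup (generatorMatrix G) i) (j ↑ˡ n))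
                                                       ≡⟨ sum-cong-≗ (λ i → cong (lookup x i ∧_) (entry i)) ⟩
    sum (λ i → lookup x i ∧ does (i Fin.≟ j))          ≡⟨ sum-single _ j off ⟩
    lookup x j ∧ does (j Fin.≟ j)                      ≡⟨ cong (lookup x j ∧_) (dec-true (j Fin.≟ j) refl) ⟩
    lookup x j ∧ true                                  ≡⟨ Bool.∧-identityʳ (lookup x j) ⟩
    lookup x j                                         ∎
    where
    open ≡-Reasoning
    entry : ∀ i → lookup (lookup (generatorMatrix G) i) (j ↑ˡ n) ≡ does (i Fin.≟ j)
    entry i = begin
      lookup (lookup (generatorMatrix G) i) (j ↑ˡ n)   ≡⟨ cong (λ r → lookup r (j ↑ˡ n)) (lookup-generator i) ⟩
      lookup (lookup I i Vec.++ lookup A i) (j ↑ˡ n)   ≡⟨ Vec.lookup-++ˡ (lookup I i) _ j ⟩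
      lookup (lookup I i) j                            ≡⟨ cong (λ r → lookup r j) (Vec.lookup∘tabulate _ i) ⟩
      lookup (tabulate (λ k → does (i Fin.≟ k))) j     ≡⟨ Vec.lookup∘tabulate _ j ⟩
      does (i Fin.≟ j)                                 ∎
    off : ∀ i → i ≢ j → lookup x i ∧ does (i Fin.≟ j) ≡ false
    off i i≢j = trans (cong (lookup x i ∧_) (dec-false (i Fin.≟ j) i≢j)) (Bool.∧-zeroʳ (lookup x i))

  lookup-encodeʳ : ∀ x q → lookup (encode G x) (n ↑ʳ q) ≡ sum (λ i → lookup x i ∧ adj G i q)
  lookup-encodeʳ x q =
    trans (lookup-combination x (generatorMatrix G) (n ↑ʳ q))
          (sum-cong-≗ (λ i → cong (lookup x i ∧_) (entry i)))
    where
    open ≡-Reasoning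
    entry : ∀ i → lookup (lookup (generatorMatrix G) i) (n ↑ʳ q) ≡ adj G i q
    entry i = begin
      lookup (lookup (generatorMatrix G) i) (n ↑ʳ q)   ≡⟨ cong (λ r → lookup r (n ↑ʳ q)) (lookup-generator i) ⟩
      lookup (lookup I i Vec.++ lookup A i) (n ↑ʳ q)   ≡⟨ Vec.lookup-++ʳ (lookup I i) _ q ⟩
      lookup (lookup A i) q                            ≡⟨ cong (λ r → lookup r q) (Vec.lookup∘tabulate _ i) ⟩
      lookup (tabulate (adj G i)) q                    ≡⟨ Vec.lookup∘tabulate _ q ⟩
      adj G i q                                        ∎

  encode-injective : ∀ x y → encode G x ≡ encode G y → ∀ i → lookup x i ≡ lookup y i
  encode-injective x y eq i =
    trans (sym (lookup-encodeˡ x i))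
          (trans (cong (λ c → lookup c (i ↑ˡ n)) eq) (lookup-encodeˡ y i))

lookup-⊆ : ∀ {m} {c d : Word m} → c ⊆ d → ∀ i → lookup c i ≡ true → lookup d i ≡ true
lookup-⊆ {c = c} c⊆d i ci = Vec.[]=⇒lookup (c⊆d (Vec.lookup⇒[]= i c ci))

≗⇒≡ : ∀ {m} {c d : Word m} → (∀ i → lookup c i ≡ lookup d i) → c ≡ d
≗⇒≡ {c = c} {d} eq =
  trans (sym (Vec.tabulate∘lookup c)) (trans (Vec.tabulate-cong eq) (Vec.tabulate∘lookup d))

combination-𝟎 : ∀ {k m} (R : Matrix k m) → combination 𝟎 R ≡ 𝟎
combination-𝟎 Vec.[]      = refl
combination-𝟎 (r Vec.∷ R) = ≗⇒≡ λ i →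
  trans (Vec.lookup-zipWith _xor_ i (false · r) (combination 𝟎 R))
        (cong₂ _xor_ (Vec.lookup-map i (false ∧_) r) (cong (λ c → lookup c i) (combination-𝟎 R)))

infix 4 _∈ˡ?_

_∈ˡ?_ : ∀ {n} (i : Fin n) (l : List (Fin n)) → Dec (i ∈ l)
_∈ˡ?_ = member? Fin._≟_

-- The characteristic vector of the set of entries of the list.
indicator : ∀ {n} → List (Fin n) → Word n
indicator l = tabulate (λ i → does (i ∈ˡ? l))

indicator⁺ : ∀ {n i} {l : List (Fin n)} → i ∈ l → lookup (indicator l) i ≡ true
indicator⁺ {i = i} {l} i∈l = trans (Vec.lookup∘tabulate _ i) (dec-true (i ∈ˡ? l) i∈l)

indicator⁻ : ∀ {n i} {l : List (Fin n)} → lookup (indicator l) i ≡ true → i ∈ l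
indicator⁻ {i = i} {l} eq = does-true⁻ (i ∈ˡ? l) (trans (sym (Vec.lookup∘tabulate _ i)) eq)

-- Induced paths of the nearness relation

-- Equality of unordered pairs.
SameEnds : ∀ {A : Set} → A × A → A × A → Set
SameEnds (u , v) (u′ , v′) = (u ≡ u′ × v ≡ v′) ⊎ (u ≡ v′ × v ≡ u′)

module _ {n} (G : Graph n) where

  private
    V : Set
    V = Fin n

  -- Equal or with a common neighbour in G.
  Near : V → V → Set
  Near u v = u ≡ v ⊎ ∃[ q ] (Adj G u q × Adj G v q)

  near? : ∀ u v → Dec (Near u v)
  near? u v = (u Fin.≟ v) ⊎-dec Fin.any? (λ q → (adj G u q Bool.≟ true) ×-dec (adj G v q Bool.≟ true))

  near-sym : ∀ {u v} → Near u v → Near v u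
  near-sym (inj₁ refl)         = inj₁ refl
  near-sym (inj₂ (q , uq , vq)) = inj₂ (q , vq , uq)

  -- Induced u v l: the list l is a path from u to v in which exactly the
  -- consecutive vertices, and the equal ones, are near.
  data Induced : V → V → List V → Set where
    [-]  : ∀ {v} → Induced v v [ v ]
    cons : ∀ {u w v l} → Near u w → u ≢ w → All (λ x → ¬ Near u x) l →
           Induced w v (w ∷ l) → Induced u v (u ∷ w ∷ l)

  last∈ : ∀ {u v l} → Induced u v l → v ∈ l
  last∈ [-]            = here refl
  last∈ (cons _ _ _ p) = there (last∈ p)

  head∈ : ∀ {u v l} → Induced u v l → u ∈ l
  head∈ [-]            = here refl
  head∈ (cons _ _ _ _) = here refl

  -- If u is near some vertex of the path, then u followed by the part of the
  -- path from the last vertex near u on is again induced, up to dropping a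
  -- repeated u.
  shortcut : ∀ {u w v l} → Induced w v l → Any (Near u) l → ∃ (Induced u v)
  shortcut {u} {w} [-] (here near) with u Fin.≟ w
  ... | yes refl = _ , [-]
  ... | no  u≢w  = _ , cons near u≢w [] [-]
  shortcut {u} {w} path@(cons {l = l} _ _ _ p) a with Any.any? (near? u) (_ ∷ l)
  ... | yes later = shortcut p later
  shortcut path@(cons _ _ _ p) (there a) | no none = contradiction a none
  shortcut {u} {w} path@(cons _ _ _ p) (here near) | no none with u Fin.≟ w
  ... | yes refl = _ , path
  ... | no  u≢w  = _ , cons near u≢w (All.¬Any⇒All¬ _ none) path

  near-head : ∀ {u w x l} → All (λ y → ¬ Near u y) l → x ∈ u ∷ w ∷ l → Near u x → x ≡ u ⊎ x ≡ w
  near-head far (here x≡u)          near = inj₁ x≡u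
  near-head far (there (here x≡w))  near = inj₂ x≡w
  near-head far (there (there x∈l)) near = contradiction near (All.lookup far x∈l)

  triangle-free : ∀ {u v l x y z} → Induced u v l → x ∈ l → y ∈ l → z ∈ l →
    Near x y → Near y z → Near x z → x ≡ y ⊎ y ≡ z ⊎ x ≡ z
  triangle-free [-] (here refl) (here refl) _ _ _ _ = inj₁ refl
  triangle-free (cons _ _ _ p) (there x) (there y) (there z) xy yz xz = triangle-free p x y z xy yz xz
  triangle-free (cons _ _ far _) (here refl) y z xy yz xz with near-head far y xy | near-head far z xz
  ... | inj₁ y≡u | _        = inj₁ (sym y≡u)
  ... | inj₂ _   | inj₁ z≡u = inj₂ (inj₂ (sym z≡u))
  ... | inj₂ y≡w | inj₂ z≡w = inj₂ (inj₁ (trans y≡w (sym z≡w)))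
  triangle-free (cons _ _ far _) x@(there _) (here refl) z xy yz xz
    with near-head far x (near-sym xy) | near-head far z yz
  ... | inj₁ x≡u | _        = inj₁ x≡u
  ... | inj₂ _   | inj₁ z≡u = inj₂ (inj₁ (sym z≡u))
  ... | inj₂ x≡w | inj₂ z≡w = inj₂ (inj₂ (trans x≡w (sym z≡w)))
  triangle-free (cons _ _ far _) x@(there _) y@(there _) (here refl) xy yz xz
    with near-head far x (near-sym xz) | near-head far y (near-sym yz)
  ... | inj₁ x≡u | _        = inj₂ (inj₂ x≡u)
  ... | inj₂ _   | inj₁ y≡u = inj₂ (inj₁ y≡u)
  ... | inj₂ x≡w | inj₂ y≡w = inj₁ (trans x≡w (sym y≡w))

  -- A function that agrees on distinct near vertices of a path is constant on it.
  constant-on : ∀ {B : Set} {u v l} (f : V → B) → Induced u v l →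
    (∀ {p p′} → p ∈ l → p′ ∈ l → p ≢ p′ → Near p p′ → f p ≡ f p′) →
    ∀ {x} → x ∈ l → f x ≡ f u
  constant-on f [-] agree (here refl) = refl
  constant-on f (cons _ _ _ _) agree (here refl) = refl
  constant-on f (cons near u≢w _ p) agree (there x∈) =
    trans (constant-on f p (λ a b → agree (there a) (there b)) x∈)
          (sym (agree (here refl) (there (here refl)) u≢w near))

  -- Ends of an induced path, told from its vertex set alone

  -- IsEnd l x: at most one vertex of l other than x is near x.
  IsEnd : List V → V → Set
  IsEnd l x = ∀ {y z} → y ∈ l → z ∈ l → y ≢ x → z ≢ x → Near x y → Near x z → y ≡ z

  first-isEnd : ∀ {u v l} → Induced u v l → IsEnd l u
  first-isEnd [-] (here y≡u) _ y≢u _ _ _ = contradiction y≡u y≢u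
  first-isEnd (cons _ _ far _) y z y≢u z≢u uy uz with near-head far y uy | near-head far z uz
  ... | inj₁ y≡u | _        = contradiction y≡u y≢u
  ... | inj₂ _   | inj₁ z≡u = contradiction z≡u z≢u
  ... | inj₂ y≡w | inj₂ z≡w = trans y≡w (sym z≡w)

  last-isEnd : ∀ {u v l} → Induced u v l → IsEnd l v
  last-isEnd [-] (here y≡u) _ y≢u _ _ _ = contradiction y≡u y≢u
  last-isEnd (cons _ _ _ p) (there y) (there z) y≢v z≢v vy vz = last-isEnd p y z y≢v z≢v vy vz
  last-isEnd (cons _ _ _ p) (here refl) (here refl) y≢v z≢v vy vz = refl
  last-isEnd (cons _ _ _ [-]) (here refl) (there (here z≡v)) y≢v z≢v vy vz = contradiction z≡v z≢v
  last-isEnd (cons _ _ _ [-]) (there (here y≡v)) (here refl) y≢v z≢v vy vz = contradiction y≡v y≢v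
  last-isEnd (cons _ _ far (cons _ _ _ p)) (here refl) (there _) y≢v z≢v vy vz =
    contradiction (near-sym vy) (All.lookup far (last∈ p))
  last-isEnd (cons _ _ far (cons _ _ _ p)) (there _) (here refl) y≢v z≢v vy vz =
    contradiction (near-sym vz) (All.lookup far (last∈ p))

  isEnd⇒first∨last : ∀ {u v l x} → Induced u v l → x ∈ l → IsEnd l x → x ≡ u ⊎ x ≡ v
  isEnd⇒first∨last [-]             (here x≡u) end = inj₁ x≡u
  isEnd⇒first∨last (cons _ _ _ _)  (here x≡u) end = inj₁ x≡u
  isEnd⇒first∨last (cons near u≢w far p) (there x∈) end
    with isEnd⇒first∨last p x∈ (λ y z → end (there y) (there z))
  ... | inj₂ x≡v = inj₂ x≡v
  isEnd⇒first∨last (cons near u≢w far [-]) (there x∈) end | inj₁ x≡w = inj₂ x≡w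
  -- An inner vertex w has two distinct near vertices: its predecessor u and its
  -- successor.
  isEnd⇒first∨last (cons near u≢w (¬near ∷ _) (cons near′ w≢y _ _)) (there x∈) end | inj₁ refl =
    contradiction (inj₁ (end (here refl) (there (there (here refl))) u≢w (≢-sym w≢y) (near-sym near) near′)) ¬near

  isEnd-resp : ∀ {l l′ x} → (∀ {y} → y ∈ l′ → y ∈ l) → IsEnd l x → IsEnd l′ x
  isEnd-resp sub end y z = end (sub y) (sub z)

  ends-unique : ∀ {u v u′ v′ l l′} → Induced u v l → Induced u′ v′ l′ →
    (∀ {x} → x ∈ l → x ∈ l′) → (∀ {x} → x ∈ l′ → x ∈ l) →
    SameEnds (u , v) (u′ , v′)
  ends-unique p p′ sub sup
    with isEnd⇒first∨last p′ (sub (head∈ p)) (isEnd-resp sup (first-isEnd p))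
       | isEnd⇒first∨last p′ (sub (last∈ p)) (isEnd-resp sup (last-isEnd p))
       | isEnd⇒first∨last p (sup (head∈ p′)) (isEnd-resp sub (first-isEnd p′))
       | isEnd⇒first∨last p (sup (last∈ p′)) (isEnd-resp sub (last-isEnd p′))
  ... | inj₁ a | inj₂ b | _      | _      = inj₁ (a , b)
  ... | inj₂ a | inj₁ b | _      | _      = inj₂ (a , b)
  ... | inj₁ a | inj₁ b | _      | inj₁ d = inj₁ (a , trans b (trans (sym a) (sym d)))
  ... | inj₁ a | inj₁ b | _      | inj₂ d = inj₁ (a , sym d)
  ... | inj₂ a | inj₂ b | inj₁ c | _      = inj₁ (sym c , b)
  ... | inj₂ a | inj₂ b | inj₂ c | _      = inj₂ (a , sym c)

  -- Minimality

  -- Let y be the characteristic vector of a subset of the path.  A common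
  -- neighbour q of two distinct vertices p and p′ of the path has no third
  -- neighbour on it, as that would make a triangle, so the coordinate of the
  -- codeword of y at q depends on y p and y p′ only.
  parity-at-common-neighbour : ∀ {u v l p p′ q} → Induced u v l → p ∈ l → p′ ∈ l → p ≢ p′ → Adj G p q → Adj G p′ q →
    ∀ y → (∀ i → lookup y i ≡ true → i ∈ l) →
    sum (λ i → lookup y i ∧ adj G i q) ≡ lookup y p xor lookup y p′
  parity-at-common-neighbour {l = l} {p} {p′} {q} path p∈ p′∈ p≢p′ pq p′q y y⊆l = begin
    sum (λ i → lookup y i ∧ adj G i q)                    ≡⟨ sum-pair _ p≢p′ off ⟩
    (lookup y p ∧ adj G p q) xor (lookup y p′ ∧ adj G p′ q)
      ≡⟨ cong₂ (λ a b → (lookup y p ∧ a) xor (lookup y p′ ∧ b)) pq p′q ⟩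
    (lookup y p ∧ true) xor (lookup y p′ ∧ true)
      ≡⟨ cong₂ _xor_ (Bool.∧-identityʳ (lookup y p)) (Bool.∧-identityʳ (lookup y p′)) ⟩
    lookup y p xor lookup y p′                            ∎
    where
    open ≡-Reasoning
    off : ∀ i → i ≢ p → i ≢ p′ → lookup y i ∧ adj G i q ≡ false
    off i i≢p i≢p′ with lookup y i in yi | adj G i q in iq
    ... | false | _     = refl
    ... | true  | false = refl
    ... | true  | true
      with triangle-free path (y⊆l i yi) p∈ p′∈ (inj₂ (q , iq , pq)) (inj₂ (q , pq , p′q)) (inj₂ (q , iq , p′q))
    ...   | inj₁ i≡p         = contradiction i≡p i≢p
    ...   | inj₂ (inj₁ p≡p′) = contradiction p≡p′ p≢p′
    ...   | inj₂ (inj₂ i≡p′) = contradiction i≡p′ i≢p′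

  induced⇒minimal : ∀ {u v l} → Induced u v l → IsMinimal (code G) (encode G (indicator l))
  induced⇒minimal {u} {v} {l} path = (x , refl) , x≢𝟎 , noSmaller
    where
    x = indicator l

    x≢𝟎 : encode G x ≢ 𝟎
    x≢𝟎 eq with trans (sym (indicator⁺ (head∈ path)))
                   (trans (sym (lookup-encodeˡ G x u))
                   (trans (cong (λ c → lookup c (u ↑ˡ n)) eq) (Vec.lookup-replicate (u ↑ˡ n) false)))
    ... | ()

    noSmaller : ¬ (∃[ c ] (code G c × c ≢ 𝟎 × (supp c ⊂ supp (encode G x))))
    noSmaller (_ , (y , refl) , c≢𝟎 , c⊆ , (j , j∈ , j∉)) = case-u (lookup y u) refl
      where
      y⊆l : ∀ i → lookup y i ≡ true → i ∈ l
      y⊆l i yi = indicator⁻ (trans (sym (lookup-encodeˡ G x i))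
                   (lookup-⊆ c⊆ (i ↑ˡ n) (trans (lookup-encodeˡ G y i) yi)))

      odd-⊆ : ∀ q → sum (λ i → lookup y i ∧ adj G i q) ≡ true → sum (λ i → lookup x i ∧ adj G i q) ≡ true
      odd-⊆ q odd = trans (sym (lookup-encodeʳ G x q))
                      (lookup-⊆ c⊆ (n ↑ʳ q) (trans (lookup-encodeʳ G y q) odd))

      agree : ∀ {p p′} → p ∈ l → p′ ∈ l → p ≢ p′ → Near p p′ → lookup y p ≡ lookup y p′
      agree p∈ p′∈ p≢p′ (inj₁ p≡p′) = contradiction p≡p′ p≢p′
      agree {p} {p′} p∈ p′∈ p≢p′ (inj₂ (q , pq , p′q)) =
        xor-false⁻ _ _ (trans (sym (parity-at-common-neighbour path p∈ p′∈ p≢p′ pq p′q y y⊆l)) (Bool.¬-not not-odd))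
        where
        -- Both p and p′ lie in the path, so the coordinate at q is 1 + 1.
        x-even : sum (λ i → lookup x i ∧ adj G i q) ≡ false
        x-even = trans (parity-at-common-neighbour path p∈ p′∈ p≢p′ pq p′q x (λ i → indicator⁻))
                       (cong₂ _xor_ (indicator⁺ p∈) (indicator⁺ p′∈))
        not-odd : sum (λ i → lookup y i ∧ adj G i q) ≢ true
        not-odd odd with trans (sym (odd-⊆ q odd)) x-even
        ... | ()

      -- The smaller codeword is thus empty or the whole, according to y at u.
      constant : ∀ {i} → i ∈ l → lookup y i ≡ lookup y u
      constant = constant-on (lookup y) path agree

      case-u : ∀ b → lookup y u ≡ b → ⊥
      case-u false yu = c≢𝟎 (trans (cong (encode G) y≡𝟎) (combination-𝟎 (generatorMatrix G)))
        where
        y≡𝟎 : y ≡ 𝟎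
        y≡𝟎 = ≗⇒≡ λ i → trans (Bool.¬-not (λ yi → Bool.not-¬ yu (trans (sym (constant (y⊆l i yi))) yi)))
                              (sym (Vec.lookup-replicate i false))
      case-u true yu = j∉ (subst (λ z → j ∈ˢ encode G z) (sym y≡x) j∈)
        where
        y≡x : y ≡ x
        y≡x = ≗⇒≡ λ i → same i (i ∈ˡ? l)
          where
          same : ∀ i → Dec (i ∈ l) → lookup y i ≡ lookup x i
          same i (yes i∈) = trans (constant i∈) (trans yu (sym (indicator⁺ i∈)))
          same i (no  i∉) = trans (Bool.¬-not (i∉ ∘ y⊆l i)) (sym (Bool.¬-not (i∉ ∘ indicator⁻)))

-- Joining vertices of the same colour

-- The tree is walked two edges at a time, which preserves the colour and leads
-- to a near vertex.
join : ∀ {n} (G T : Graph n) → (∀ u v → Adj T u v → Adj G u v) →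
  (κ : Fin n → Bool) → IsTwoColouring T κ →
  ∀ {u v} → Star (Adj T) u v → κ u ≡ κ v → ∃ (Induced G u v)
join G T T⊆G κ proper ε same = _ , [-]
join G T T⊆G κ proper {u} {v} (uv ◅ ε) same = contradiction same (proper u v uv)
join G T T⊆G κ proper {u} {v} (_◅_ {j = q} uq (_◅_ {j = w} qw walk)) same =
  shortcut G (proj₂ rest) (Any.map (λ { refl → near }) (head∈ G (proj₂ rest)))
  where
  κu≡κw : κ u ≡ κ w
  κu≡κw = trans (Bool.¬-not (proper u q uq)) (sym (Bool.¬-not (≢-sym (proper q w qw))))
  near : Near G u w
  near = inj₂ (q , T⊆G u q uq , T⊆G w q (trans (adj-sym T w q) qw))
  rest = join G T T⊆G κ proper walk (trans (sym κu≡κw) same)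

-- Counting

∈-allWords : ∀ {m} (c : Word m) → c ∈ allWords m
∈-allWords Vec.[]          = here refl
∈-allWords (false Vec.∷ c) = ∈-++⁺ˡ (∈-map⁺ (false Vec.∷_) (∈-allWords c))
∈-allWords {suc m} (true Vec.∷ c) =
  ∈-++⁺ʳ (map (false Vec.∷_) (allWords m)) (∈-map⁺ (true Vec.∷_) (∈-allWords c))

allPairs-lookup-injective : ∀ {A : Set} {D : A → A → Set} {xs} → AllPairs D xs →
  ∀ i j → ¬ D (List.lookup xs i) (List.lookup xs j) → ¬ D (List.lookup xs j) (List.lookup xs i) → i ≡ j
allPairs-lookup-injective (_ ∷ _)  zero    zero    _   _   = refl
allPairs-lookup-injective (ds ∷ _) zero    (suc j) ¬ij _   = contradiction (All.lookup ds (∈-lookup j)) ¬ij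
allPairs-lookup-injective (ds ∷ _) (suc i) zero    _   ¬ji = contradiction (All.lookup ds (∈-lookup i)) ¬ji
allPairs-lookup-injective (_ ∷ d)  (suc i) (suc j) ¬ij ¬ji =
  cong suc (allPairs-lookup-injective d i j ¬ij ¬ji)

-- Pigeonhole for a relation: if every element of xs has a partner in ys, and no
-- partner is shared by entries at two positions of xs, then ys is at least as
-- long as xs.
partners⇒≤ : ∀ {A B : Set} (R : A → B → Set) {xs : List A} {ys : List B} →
  (∀ {x} → x ∈ xs → ∃[ y ] (y ∈ ys × R x y)) →
  AllPairs (λ x x′ → ∀ y → ¬ (R x y × R x′ y)) xs → length xs ≤ length ys
partners⇒≤ R {xs} {ys} partner disjoint = Fin.injective⇒≤ {f = position} position-injective
  where
  found : ∀ i → ∃[ y ] (y ∈ ys × R (List.lookup xs i) y)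
  found i = partner (∈-lookup i)
  position : Fin (length xs) → Fin (length ys)
  position i = Any.index (proj₁ (proj₂ (found i)))
  position-injective : ∀ {i j} → position i ≡ position j → i ≡ j
  position-injective {i} {j} eq with found i | found j
  ... | y , y∈ , Riy | y′ , y′∈ , Rjy′ with index-injective (setoid _) y∈ y′∈ eq
  ...   | refl = allPairs-lookup-injective disjoint i j (λ d → d y (Riy , Rjy′)) (λ d → d y (Rjy′ , Riy))

-- The pairs (x , y) of entries of the list, with x at or before y.
pairs : ∀ {A : Set} → List A → List (A × A)
pairs []       = []
pairs (x ∷ xs) = map (x ,_) (x ∷ xs) ++ pairs xs

length-pairs : ∀ {A : Set} (xs : List A) → length (pairs xs) ≡ length xs + (length xs C 2)
length-pairs []       = refl
length-pairs (x ∷ xs) = begin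
  length (map (x ,_) (x ∷ xs) ++ pairs xs)             ≡⟨ List.length-++ (map (x ,_) (x ∷ xs)) ⟩
  length (map (x ,_) (x ∷ xs)) + length (pairs xs)     ≡⟨ cong₂ _+_ (List.length-map (x ,_) (x ∷ xs)) (length-pairs xs) ⟩
  suc k + (k + (k C 2))                                ≡⟨ cong (λ m → suc k + (m + (k C 2))) (nC1≡n k) ⟨
  suc k + ((k C 1) + (k C 2))                          ≡⟨ cong (suc k +_) (nCk+nC[k+1]≡[n+1]C[k+1] k 1) ⟩
  suc k + (suc k C 2)                                  ∎
  where
  open ≡-Reasoning
  k = length xs

all-pairs : ∀ {A : Set} {P : A → Set} {xs} → All P xs → All (λ p → P (proj₁ p) × P (proj₂ p)) (pairs xs)
all-pairs []         = []
all-pairs (px ∷ pxs) = All.++⁺ (All.map⁺ (All.map (px ,_) (px ∷ pxs))) (all-pairs pxs)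

pairs-distinct : ∀ {A : Set} {xs : List A} → Unique xs → AllPairs (λ p q → ¬ SameEnds p q) (pairs xs)
pairs-distinct []                = []
pairs-distinct u@(x∉xs ∷ unique) = AllPairs.++⁺
  (AllPairs.map⁺ (AllPairs.map (λ { y≢y′ (inj₁ (_ , y≡y′)) → y≢y′ y≡y′
                                  ; y≢y′ (inj₂ (x≡y′ , y≡x)) → y≢y′ (trans y≡x x≡y′) }) u))
  (pairs-distinct unique)
  (All.map⁺ (All.tabulate λ _ → All.map
    (λ { (x≢x′ , _) (inj₁ (x≡x′ , _)) → x≢x′ x≡x′
       ; (_ , x≢y′) (inj₂ (x≡y′ , _)) → x≢y′ x≡y′ }) (all-pairs x∉xs)))

count-filter : ∀ {n} {A : Set} {P : A → Set} (P? : Unary.Decidable P) (f : Fin n → A) →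
  ∣ tabulate (λ i → does (P? (f i))) ∣ ≡ length (filter P? (List.tabulate f))
count-filter {zero}  P? f = refl
count-filter {suc n} P? f with does (P? (f zero))
... | true  = cong suc (count-filter P? (f ∘ suc))
... | false = count-filter P? (f ∘ suc)

module _ {n} (κ : Fin n → Bool) where

  members : Bool → List (Fin n)
  members c = filter (λ v → κ v Bool.≟ c) (allFin n)

  length-members : ∀ c → length (members c) ≡ ∣ colourClass κ c ∣
  length-members c = sym (count-filter (λ v → κ v Bool.≟ c) id)

  members-colour : ∀ c → All (λ v → κ v ≡ c) (members c)
  members-colour c = All.all-filter (λ v → κ v Bool.≟ c) (allFin n)

  members-unique : ∀ c → Unique (members c)
  members-unique c = Unique.filter⁺ (λ v → κ v Bool.≟ c) (Unique.allFin⁺ n)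

  -- Each unordered pair of vertices of the same colour, once.
  colourPairs : List (Fin n × Fin n)
  colourPairs = pairs (members true) ++ pairs (members false)

  length-colourPairs : let a = ∣ colourClass κ true ∣
                           b = ∣ colourClass κ false ∣
                       in length colourPairs ≡ a + b + (a C 2) + (b C 2)
  length-colourPairs
    rewrite List.length-++ (pairs (members true)) {pairs (members false)}
          | length-pairs (members true) | length-pairs (members false)
          | length-members true | length-members false =
    solve 4 (λ a b c d → (a :+ c) :+ (b :+ d) := a :+ b :+ c :+ d) refl
      (∣ colourClass κ true ∣) (∣ colourClass κ false ∣) (∣ colourClass κ true ∣ C 2) (∣ colourClass κ false ∣ C 2)
    where open +-*-Solver

  colourPairs-distinct : AllPairs (λ p q → ¬ SameEnds p q) colourPairs
  colourPairs-distinct = AllPairs.++⁺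
    (pairs-distinct (members-unique true))
    (pairs-distinct (members-unique false))
    (All.map (λ (t , _) → All.map (λ (f , f′) → λ
        { (inj₁ (refl , _)) → Bool.not-¬ t f
        ; (inj₂ (refl , _)) → Bool.not-¬ t f′ })
      (all-pairs (members-colour false)))
    (all-pairs (members-colour true)))

  colourPairs-same : All (λ p → κ (proj₁ p) ≡ κ (proj₂ p)) colourPairs
  colourPairs-same = All.++⁺ (same true) (same false)
    where
    same : ∀ c → All (λ p → κ (proj₁ p) ≡ κ (proj₂ p)) (pairs (members c))
    same c = All.map (λ (p , q) → trans p (sym q)) (all-pairs (members-colour c))

-- c is the codeword of the vertex set of an induced path between the two vertices.
Represents : ∀ {n} (G : Graph n) → Fin n × Fin n → Word (n + n) → Set
Represents G (u , v) c = ∃[ l ] (Induced G u v l × c ≡ encode G (indicator l))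

represents-unique : ∀ {n} (G : Graph n) {p q c} → Represents G p c → Represents G q c → SameEnds p q
represents-unique G (l , path , refl) (l′ , path′ , eq) = ends-unique G path path′
  (λ {x} x∈ → indicator⁻ (trans (sym (same x)) (indicator⁺ x∈)))
  (λ {x} x∈ → indicator⁻ (trans (same x) (indicator⁺ x∈)))
  where
  same : ∀ x → lookup (indicator l) x ≡ lookup (indicator l′) x
  same = encode-injective G (indicator l) (indicator l′) eq

lemma3p10 :
    ∀ {n : ℕ} (G T : Graph n) → Connected G → T IsSpanningTreeOf G →
    (κ : Fin n → Bool) → IsTwoColouring T κ →
    let a = ∣ colourClass κ true ∣
        b = ∣ colourClass κ false ∣
    in M G ≥ a + b + (a C 2) + (b C 2)
lemma3p10 {n} G T _ ((connected , _) , T⊆G) κ proper =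
  subst (_≤ M G) (length-colourPairs κ) (partners⇒≤ (Represents G) represent
    (AllPairs.map (λ ¬same c (r , r′) → ¬same (represents-unique G r r′)) (colourPairs-distinct κ)))
  where
  minimal? = isMinimal? (rowSpan? (generatorMatrix G))
  represent : ∀ {p} → p ∈ colourPairs κ →
    ∃[ c ] (c ∈ filter minimal? (allWords (n + n)) × Represents G p c)
  represent {u , v} p∈
    with l , path ← join G T T⊆G κ proper (connected u v) (All.lookup (colourPairs-same κ) p∈) =
    encode G (indicator l)
    , ∈-filter⁺ minimal? (∈-allWords _) (induced⇒minimal G path)
    , l , path , refl
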